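{- Let $a,b$ be non-zero real numbers, and let $(J_n)_{n\ge 0}$ be the bi-periodic Jacobsthal matrix sequence associated with $a,b$. Then for every positive integer $n$, $$\sum_{k=0}^{n-1}J_k=\frac{J_n\left(1-a^{\varepsilon(n)}b^{1-\varepsilon(n)}\right)+2J_{n-1}\left(1-a^{1-\varepsilon(n)}b^{\varepsilon(n)}\right)+J_1(a-1)+J_0(2b-ab-1)}{1-ab}.$$
   Context: Fix non-zero real numbers $a,b$. The parity function is $\varepsilon(n)=0$ if $n$ is even and $\varepsilon(n)=1$ if $n$ is odd. The bi-periodic Jacobsthal matrix sequence $(J_n)_{n\ge 0}$ of $2\times 2$ real matrices is defined by $J_0=\begin{pmatrix}1&0\\0&1\end{pmatrix}$, $J_1=\begin{pmatrix} b & 2\frac{b}{a}\\ 1&0\end{pmatrix}$, and for $n\ge 2$: $J_n=aJ_{n-1}+2J_{n-2}$ if $n$ is even, $J_n=bJ_{n-1}+2J_{n-2}$ if $n$ is odd. -}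

module Defs where

open import Level using (Level; 0ℓ)
open import Algebra.Apartness.Bundles using (HeytingField; HeytingCommutativeRing)
open import Algebra.Bundles using (CommutativeRing; RawMonoid)
open import Data.Fin.Base using (Fin; toℕ)
open import Data.Nat.Base as ℕ using (ℕ; suc)
import Data.Integer.Base as ℤ
import Data.Nat.Properties as ℕₚ
open import Data.Parity.Base using (Parity; 0ℙ; 1ℙ)
open import Data.Product.Base using (∃-syntax; _×_; _,_; proj₁; proj₂)
open import Data.Rational.Base as ℚ using (ℚ; 0ℚ; 1ℚ; ½; ∣_∣)
import Data.Rational.Properties as ℚₚ
open import Data.Rational.Solver using (module +-*-Solver)
open import Data.Sum.Base using (_⊎_; inj₁; inj₂)
open import Data.Vec.Functional using (Vector; []; _∷_)
open import Relation.Binary.PropositionalEquality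
  using (_≡_; _≢_; refl; sym; trans; cong; cong₂; subst; subst₂)
open import Relation.Nullary using (¬_; yes; no; contradiction)

-- The standard library has no reals.  They are constructed here as Cauchy
-- sequences of rationals, two sequences being equal when their difference
-- tends to 0.  The relation `x # y` (the difference is eventually bounded
-- away from 0) is the constructive reading of x ≠ y: classically it is
-- the negation of `x ≈ y`, by `¬#⇒≈` below.

Eventually : (ℕ → Set) → Set
Eventually P = ∃[ N ] (∀ n → N ℕ.≤ n → P n)

IsNull : (ℕ → ℚ) → Set
IsNull s = ∀ ε → 0ℚ ℚ.< ε → Eventually (λ n → ∣ s n ∣ ℚ.< ε)

IsCauchy : (ℕ → ℚ) → Set
IsCauchy s = ∀ ε → 0ℚ ℚ.< ε →
  ∃[ N ] (∀ m n → N ℕ.≤ m → N ℕ.≤ n → ∣ s m ℚ.- s n ∣ ℚ.< ε)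

AwayFrom0 : (ℕ → ℚ) → Set
AwayFrom0 s = ∃[ ε ] (0ℚ ℚ.< ε × Eventually (λ n → ε ℚ.< ∣ s n ∣))

Bounded : (ℕ → ℚ) → Set
Bounded s = ∃[ B ] (0ℚ ℚ.< B × Eventually (λ n → ∣ s n ∣ ℚ.≤ B))

record ℝ : Set where
  constructor mkℝ
  field
    seq    : ℕ → ℚ
    cauchy : IsCauchy seq

open ℝ

module RealField where

  infix 4 _≈_ _#_

  _≈_ : ℝ → ℝ → Set
  x ≈ y = IsNull (λ n → seq x n ℚ.- seq y n)

  _#_ : ℝ → ℝ → Set
  x # y = AwayFrom0 (λ n → seq x n ℚ.- seq y n)

  open ℚₚ.≤-Reasoning
  open +-*-Solver using (solve; _:=_; _:+_; _:*_; _:-_; :-_; con)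

  private abstract

    zip-eventually : ∀ {P Q R : ℕ → Set} → (∀ n → P n → Q n → R n) →
                     Eventually P → Eventually Q → Eventually R
    zip-eventually f (M , p) (N , q) = M ℕ.⊔ N , λ n le →
      f n (p n (ℕₚ.m⊔n≤o⇒m≤o M N le)) (q n (ℕₚ.m⊔n≤o⇒n≤o M N le))

    map-eventually : ∀ {P Q : ℕ → Set} → (∀ n → P n → Q n) →
                     Eventually P → Eventually Q
    map-eventually f (N , p) = N , λ n le → f n (p n le)

    ≤⇒≯ : ∀ {p q} → p ℚ.≤ q → ¬ (q ℚ.< p)
    ≤⇒≯ p≤q q<p = ℚₚ.<-irrefl refl (ℚₚ.≤-<-trans p≤q q<p)

    pos-* : ∀ {p q} → 0ℚ ℚ.< p → 0ℚ ℚ.< q → 0ℚ ℚ.< p ℚ.* q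
    pos-* {p} {q} 0<p 0<q = ℚₚ.positive⁻¹ (p ℚ.* q)
      {{ℚₚ.pos*pos⇒pos p {{ℚ.positive 0<p}} q {{ℚ.positive 0<q}}}}

    0<½ : 0ℚ ℚ.< ½
    0<½ = ℚₚ.positive⁻¹ ½

    0<1 : 0ℚ ℚ.< 1ℚ
    0<1 = ℚₚ.positive⁻¹ 1ℚ

    ½+½ : ∀ ε → ε ℚ.* ½ ℚ.+ ε ℚ.* ½ ≡ ε
    ½+½ = solve 1 (λ e → e :* con ½ :+ e :* con ½ := e) refl

    recip⁺ : ∀ ε → 0ℚ ℚ.< ε → ∃[ δ ] (0ℚ ℚ.< δ × ε ℚ.* δ ≡ 1ℚ)
    recip⁺ ε 0<ε =
      (ℚ.1/ ε) {{ε≢0}} ,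
      ℚₚ.positive⁻¹ ((ℚ.1/ ε) {{ε≢0}}) {{ℚₚ.1/pos⇒pos ε {{ε>0}}}} ,
      ℚₚ.*-inverseʳ ε {{ε≢0}}
      where
      ε>0 : ℚ.Positive ε
      ε>0 = ℚ.positive 0<ε
      ε≢0 : ℚ.NonZero ε
      ε≢0 = ℚₚ.pos⇒nonZero ε {{ε>0}}

    ∣p-q∣≡∣q-p∣ : ∀ p q → ∣ p ℚ.- q ∣ ≡ ∣ q ℚ.- p ∣
    ∣p-q∣≡∣q-p∣ p q = trans
      (cong ∣_∣ (solve 2 (λ p q → p :- q := :- (q :- p)) refl p q))
      (ℚₚ.∣-p∣≡∣p∣ (q ℚ.- p))

    ∣+∣< : ∀ {p q α β} → ∣ p ∣ ℚ.< α → ∣ q ∣ ℚ.< β → ∣ p ℚ.+ q ∣ ℚ.< α ℚ.+ β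
    ∣+∣< {p} {q} p<α q<β =
      ℚₚ.≤-<-trans (ℚₚ.∣p+q∣≤∣p∣+∣q∣ p q) (ℚₚ.+-mono-< p<α q<β)

    ∣*∣< : ∀ {p q α β} → 0ℚ ℚ.< α → ∣ p ∣ ℚ.≤ α → ∣ q ∣ ℚ.< β →
           ∣ p ℚ.* q ∣ ℚ.< α ℚ.* β
    ∣*∣< {p} {q} {α} {β} 0<α p≤α q<β = begin-strict
      ∣ p ℚ.* q ∣         ≡⟨ ℚₚ.∣p*q∣≡∣p∣*∣q∣ p q ⟩
      ∣ p ∣ ℚ.* ∣ q ∣     ≤⟨ ℚₚ.*-monoʳ-≤-nonNeg ∣ q ∣ {{ℚₚ.∣-∣-nonNeg q}} p≤α ⟩
      α ℚ.* ∣ q ∣         <⟨ ℚₚ.*-monoʳ-<-pos α {{ℚ.positive 0<α}} q<β ⟩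
      α ℚ.* β             ∎

    ∣p∣≤∣p-q∣+∣q∣ : ∀ p q → ∣ p ∣ ℚ.≤ ∣ p ℚ.- q ∣ ℚ.+ ∣ q ∣
    ∣p∣≤∣p-q∣+∣q∣ p q = begin
      ∣ p ∣                       ≡⟨ cong ∣_∣ (solve 2 (λ p q → p := p :- q :+ q) refl p q) ⟩
      ∣ p ℚ.- q ℚ.+ q ∣           ≤⟨ ℚₚ.∣p+q∣≤∣p∣+∣q∣ (p ℚ.- q) q ⟩
      ∣ p ℚ.- q ∣ ℚ.+ ∣ q ∣       ∎

    stays-away : ∀ {α β} p q → α ℚ.+ β ℚ.< ∣ p ∣ → ∣ p ℚ.- q ∣ ℚ.< β → α ℚ.< ∣ q ∣
    stays-away {α} {β} p q α+β<p p-q<β with α ℚₚ.<? ∣ q ∣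
    ... | yes α<q = α<q
    ... | no  α≮q = contradiction α+β<p (ℚₚ.<-asym (begin-strict
      ∣ p ∣                 ≤⟨ ∣p∣≤∣p-q∣+∣q∣ p q ⟩
      ∣ p ℚ.- q ∣ ℚ.+ ∣ q ∣ <⟨ ℚₚ.+-mono-<-≤ p-q<β (ℚₚ.≮⇒≥ α≮q) ⟩
      β ℚ.+ α               ≡⟨ ℚₚ.+-comm β α ⟩
      α ℚ.+ β               ∎))

    null-cong : ∀ {s t} → (∀ n → s n ≡ t n) → IsNull s → IsNull t
    null-cong s≡t null ε 0<ε =
      map-eventually (λ n → subst (λ p → ∣ p ∣ ℚ.< ε) (s≡t n)) (null ε 0<ε)

    null-0 : IsNull (λ _ → 0ℚ)
    null-0 ε 0<ε = 0 , λ _ _ → 0<ε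

    null-neg : ∀ {s} → IsNull s → IsNull (λ n → ℚ.- s n)
    null-neg {s} null ε 0<ε = map-eventually
      (λ n → subst (ℚ._< ε) (sym (ℚₚ.∣-p∣≡∣p∣ (s n)))) (null ε 0<ε)

    null-+ : ∀ {s t} → IsNull s → IsNull t → IsNull (λ n → s n ℚ.+ t n)
    null-+ {s} {t} s→0 t→0 ε 0<ε = zip-eventually
      (λ n s< t< → subst (∣ s n ℚ.+ t n ∣ ℚ.<_) (½+½ ε) (∣+∣< {s n} {t n} s< t<))
      (s→0 (ε ℚ.* ½) 0<ε/2) (t→0 (ε ℚ.* ½) 0<ε/2)
      where
      0<ε/2 : 0ℚ ℚ.< ε ℚ.* ½
      0<ε/2 = pos-* 0<ε 0<½

    cauchy⇒bounded : ∀ {s} → IsCauchy s → Bounded s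
    cauchy⇒bounded {s} c with c 1ℚ 0<1
    ... | N , close = 1ℚ ℚ.+ ∣ s N ∣ ,
      ℚₚ.+-mono-<-≤ 0<1 (ℚₚ.0≤∣p∣ (s N)) ,
      N , λ n N≤n → ℚₚ.≤-trans (∣p∣≤∣p-q∣+∣q∣ (s n) (s N))
        (ℚₚ.+-monoˡ-≤ ∣ s N ∣ (ℚₚ.<⇒≤ (close n N N≤n ℕₚ.≤-refl)))

    null-* : ∀ {s t} → Bounded s → IsNull t → IsNull (λ n → s n ℚ.* t n)
    null-* {s} {t} (B , 0<B , s≤B) t→0 ε 0<ε with recip⁺ B 0<B
    ... | δ , 0<δ , Bδ≡1 = zip-eventually
      (λ n s≤ t< → subst (∣ s n ℚ.* t n ∣ ℚ.<_) scale (∣*∣< {s n} {t n} 0<B s≤ t<))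
      s≤B (t→0 (δ ℚ.* ε) (pos-* 0<δ 0<ε))
      where
      scale : B ℚ.* (δ ℚ.* ε) ≡ ε
      scale = trans (sym (ℚₚ.*-assoc B δ ε))
                    (trans (cong (ℚ._* ε) Bδ≡1) (ℚₚ.*-identityˡ ε))

    ≡⇒≈ : ∀ {x y} → (∀ n → seq x n ≡ seq y n) → x ≈ y
    ≡⇒≈ {x} {y} eq = null-cong
      (λ n → sym (trans (cong (ℚ._- seq y n) (eq n)) (ℚₚ.+-inverseʳ (seq y n)))) null-0

    cauchy-const : ∀ p → IsCauchy (λ _ → p)
    cauchy-const p ε 0<ε =
      0 , λ _ _ _ _ → subst (λ q → ∣ q ∣ ℚ.< ε) (sym (ℚₚ.+-inverseʳ p)) 0<ε

    cauchy-+ : ∀ {s t} → IsCauchy s → IsCauchy t → IsCauchy (λ n → s n ℚ.+ t n)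
    cauchy-+ {s} {t} cs ct ε 0<ε
      with cs (ε ℚ.* ½) (pos-* 0<ε 0<½) | ct (ε ℚ.* ½) (pos-* 0<ε 0<½)
    ... | M , s< | N , t< = M ℕ.⊔ N , λ m n m≥ n≥ →
      subst₂ (λ p q → ∣ p ∣ ℚ.< q) (sym (regroup (s m) (t m) (s n) (t n))) (½+½ ε)
        (∣+∣< {s m ℚ.- s n} {t m ℚ.- t n}
          (s< m n (ℕₚ.m⊔n≤o⇒m≤o M N m≥) (ℕₚ.m⊔n≤o⇒m≤o M N n≥))
          (t< m n (ℕₚ.m⊔n≤o⇒n≤o M N m≥) (ℕₚ.m⊔n≤o⇒n≤o M N n≥)))
      where
      regroup : ∀ a b c d → (a ℚ.+ b) ℚ.- (c ℚ.+ d) ≡ (a ℚ.- c) ℚ.+ (b ℚ.- d)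
      regroup = solve 4 (λ a b c d → (a :+ b) :- (c :+ d) := (a :- c) :+ (b :- d)) refl

    cauchy-neg : ∀ {s} → IsCauchy s → IsCauchy (λ n → ℚ.- s n)
    cauchy-neg {s} cs ε 0<ε with cs ε 0<ε
    ... | N , s< = N , λ m n m≥ n≥ →
      subst (λ p → ∣ p ∣ ℚ.< ε) (regroup (s n) (s m)) (s< n m n≥ m≥)
      where
      regroup : ∀ a b → a ℚ.- b ≡ (ℚ.- b) ℚ.- (ℚ.- a)
      regroup = solve 2 (λ a b → a :- b := (:- b) :- (:- a)) refl

    cauchy-increments : ∀ {r s t} → IsCauchy r → IsCauchy s →
      ∃[ A ] (0ℚ ℚ.< A × ∃[ N ] (∀ m n → N ℕ.≤ m → N ℕ.≤ n →
        ∃[ p ] ∃[ q ] (∣ p ∣ ℚ.≤ A × ∣ q ∣ ℚ.≤ A ×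
          t m ℚ.- t n ≡ p ℚ.* (r m ℚ.- r n) ℚ.+ q ℚ.* (s m ℚ.- s n)))) →
      IsCauchy t
    cauchy-increments {r} {s} {t} cr cs (A , 0<A , N , incr) ε 0<ε
      with recip⁺ A 0<A
    ... | δ , 0<δ , Aδ≡1
      with cr (δ ℚ.* (ε ℚ.* ½)) (pos-* 0<δ (pos-* 0<ε 0<½))
         | cs (δ ℚ.* (ε ℚ.* ½)) (pos-* 0<δ (pos-* 0<ε 0<½))
    ... | R , r< | S , s< = N ℕ.⊔ (R ℕ.⊔ S) , λ m n m≥ n≥ →
      let (p , q , p≤ , q≤ , eq) = incr m n (≥N m≥) (≥N n≥)
      in subst₂ (λ u v → ∣ u ∣ ℚ.< v) (sym eq) scale
           (∣+∣< {p ℚ.* (r m ℚ.- r n)} {q ℚ.* (s m ℚ.- s n)}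
             (∣*∣< {p} {r m ℚ.- r n} 0<A p≤ (r< m n (≥R m≥) (≥R n≥)))
             (∣*∣< {q} {s m ℚ.- s n} 0<A q≤ (s< m n (≥S m≥) (≥S n≥))))
      where
      ≥N : ∀ {k} → N ℕ.⊔ (R ℕ.⊔ S) ℕ.≤ k → N ℕ.≤ k
      ≥N = ℕₚ.m⊔n≤o⇒m≤o N (R ℕ.⊔ S)
      ≥R : ∀ {k} → N ℕ.⊔ (R ℕ.⊔ S) ℕ.≤ k → R ℕ.≤ k
      ≥R le = ℕₚ.m⊔n≤o⇒m≤o R S (ℕₚ.m⊔n≤o⇒n≤o N (R ℕ.⊔ S) le)
      ≥S : ∀ {k} → N ℕ.⊔ (R ℕ.⊔ S) ℕ.≤ k → S ℕ.≤ k
      ≥S le = ℕₚ.m⊔n≤o⇒n≤o R S (ℕₚ.m⊔n≤o⇒n≤o N (R ℕ.⊔ S) le)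
      half : A ℚ.* (δ ℚ.* (ε ℚ.* ½)) ≡ ε ℚ.* ½
      half = trans (sym (ℚₚ.*-assoc A δ (ε ℚ.* ½)))
                   (trans (cong (ℚ._* (ε ℚ.* ½)) Aδ≡1) (ℚₚ.*-identityˡ (ε ℚ.* ½)))
      scale : A ℚ.* (δ ℚ.* (ε ℚ.* ½)) ℚ.+ A ℚ.* (δ ℚ.* (ε ℚ.* ½)) ≡ ε
      scale = trans (cong₂ ℚ._+_ half half) (½+½ ε)

    cauchy-*-bounded : ∀ {s t} → Bounded s → Bounded t →
      IsCauchy s → IsCauchy t → IsCauchy (λ n → s n ℚ.* t n)
    cauchy-*-bounded {s} {t} (A , 0<A , M , s≤A) (B , 0<B , N , t≤B) cs ct =
      cauchy-increments {s} {t} {λ n → s n ℚ.* t n} cs ct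
        ( A ℚ.+ B , ℚₚ.+-mono-< 0<A 0<B , M ℕ.⊔ N , λ m n m≥ n≥ →
          t m , s n ,
          ℚₚ.≤-trans (t≤B m (ℕₚ.m⊔n≤o⇒n≤o M N m≥)) B≤A+B ,
          ℚₚ.≤-trans (s≤A n (ℕₚ.m⊔n≤o⇒m≤o M N n≥)) A≤A+B ,
          regroup (s m) (t m) (s n) (t n))
      where
      A≤A+B : A ℚ.≤ A ℚ.+ B
      A≤A+B = subst (ℚ._≤ A ℚ.+ B) (ℚₚ.+-identityʳ A) (ℚₚ.+-monoʳ-≤ A (ℚₚ.<⇒≤ 0<B))
      B≤A+B : B ℚ.≤ A ℚ.+ B
      B≤A+B = subst (ℚ._≤ A ℚ.+ B) (ℚₚ.+-identityˡ B) (ℚₚ.+-monoˡ-≤ B (ℚₚ.<⇒≤ 0<A))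
      regroup : ∀ a b c d → a ℚ.* b ℚ.- c ℚ.* d ≡ b ℚ.* (a ℚ.- c) ℚ.+ c ℚ.* (b ℚ.- d)
      regroup = solve 4
        (λ a b c d → a :* b :- c :* d := b :* (a :- c) :+ c :* (b :- d)) refl

    cauchy-* : ∀ {s t} → IsCauchy s → IsCauchy t → IsCauchy (λ n → s n ℚ.* t n)
    cauchy-* {s} {t} cs ct =
      cauchy-*-bounded {s} {t} (cauchy⇒bounded {s} cs) (cauchy⇒bounded {t} ct) cs ct

  infixl 6 _+_ _-_
  infixl 7 _*_
  infix  8 -_

  _+_ : ℝ → ℝ → ℝ
  x + y = mkℝ (λ n → seq x n ℚ.+ seq y n) (cauchy-+ {seq x} {seq y} (cauchy x) (cauchy y))

  _*_ : ℝ → ℝ → ℝ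
  x * y = mkℝ (λ n → seq x n ℚ.* seq y n) (cauchy-* {seq x} {seq y} (cauchy x) (cauchy y))

  -_ : ℝ → ℝ
  - x = mkℝ (λ n → ℚ.- seq x n) (cauchy-neg {seq x} (cauchy x))

  _-_ : ℝ → ℝ → ℝ
  x - y = x + (- y)

  0ℝ 1ℝ : ℝ
  0ℝ = mkℝ (λ _ → 0ℚ) (cauchy-const 0ℚ)
  1ℝ = mkℝ (λ _ → 1ℚ) (cauchy-const 1ℚ)

  private abstract

    ≈-refl : ∀ {x} → x ≈ x
    ≈-refl {x} = ≡⇒≈ {x} {x} (λ _ → refl)

    ≈-sym : ∀ {x y} → x ≈ y → y ≈ x
    ≈-sym {x} {y} x≈y = null-cong
      (λ n → solve 2 (λ a b → :- (a :- b) := b :- a) refl (seq x n) (seq y n))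
      (null-neg x≈y)

    ≈-trans : ∀ {x y z} → x ≈ y → y ≈ z → x ≈ z
    ≈-trans {x} {y} {z} x≈y y≈z = null-cong
      (λ n → solve 3 (λ a b c → (a :- b) :+ (b :- c) := a :- c) refl
               (seq x n) (seq y n) (seq z n))
      (null-+ x≈y y≈z)

    +-cong : ∀ {x y u v} → x ≈ y → u ≈ v → x + u ≈ y + v
    +-cong {x} {y} {u} {v} x≈y u≈v = null-cong
      (λ n → solve 4 (λ a b c d → (a :- b) :+ (c :- d) := (a :+ c) :- (b :+ d)) refl
               (seq x n) (seq y n) (seq u n) (seq v n))
      (null-+ x≈y u≈v)

    *-cong : ∀ {x y u v} → x ≈ y → u ≈ v → x * u ≈ y * v
    *-cong {x} {y} {u} {v} x≈y u≈v = null-cong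
      (λ n → solve 4 (λ a b c d → c :* (a :- b) :+ b :* (c :- d) := a :* c :- b :* d) refl
               (seq x n) (seq y n) (seq u n) (seq v n))
      (null-+ (null-* (cauchy⇒bounded {seq u} (cauchy u)) x≈y)
              (null-* (cauchy⇒bounded {seq y} (cauchy y)) u≈v))

    neg-cong : ∀ {x y} → x ≈ y → - x ≈ - y
    neg-cong {x} {y} x≈y = null-cong
      (λ n → solve 2 (λ a b → :- (a :- b) := (:- a) :- (:- b)) refl (seq x n) (seq y n))
      (null-neg x≈y)

  commutativeRing : CommutativeRing 0ℓ 0ℓ
  commutativeRing = record
    { Carrier = ℝ ; _≈_ = _≈_ ; _+_ = _+_ ; _*_ = _*_ ; -_ = -_ ; 0# = 0ℝ ; 1# = 1ℝ
    ; isCommutativeRing = record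
      { isRing = record
        { +-isAbelianGroup = record
          { isGroup = record
            { isMonoid = record
              { isSemigroup = record
                { isMagma = record
                  { isEquivalence = record
                    { refl  = λ {x} → ≈-refl {x}
                    ; sym   = λ {x} {y} → ≈-sym {x} {y}
                    ; trans = λ {x} {y} {z} → ≈-trans {x} {y} {z}
                    }
                  ; ∙-cong = λ {x} {y} {u} {v} → +-cong {x} {y} {u} {v}
                  }
                ; assoc = λ x y z → ≡⇒≈ {(x + y) + z} {x + (y + z)}
                    (λ n → ℚₚ.+-assoc (seq x n) (seq y n) (seq z n))
                }
              ; identity = (λ x → ≡⇒≈ {0ℝ + x} {x} (λ n → ℚₚ.+-identityˡ (seq x n)))
                         , (λ x → ≡⇒≈ {x + 0ℝ} {x} (λ n → ℚₚ.+-identityʳ (seq x n)))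
              }
            ; inverse = (λ x → ≡⇒≈ {(- x) + x} {0ℝ} (λ n → ℚₚ.+-inverseˡ (seq x n)))
                      , (λ x → ≡⇒≈ {x + (- x)} {0ℝ} (λ n → ℚₚ.+-inverseʳ (seq x n)))
            ; ⁻¹-cong = λ {x} {y} → neg-cong {x} {y}
            }
          ; comm = λ x y → ≡⇒≈ {x + y} {y + x} (λ n → ℚₚ.+-comm (seq x n) (seq y n))
          }
        ; *-cong = λ {x} {y} {u} {v} → *-cong {x} {y} {u} {v}
        ; *-assoc = λ x y z → ≡⇒≈ {(x * y) * z} {x * (y * z)}
            (λ n → ℚₚ.*-assoc (seq x n) (seq y n) (seq z n))
        ; *-identity = (λ x → ≡⇒≈ {1ℝ * x} {x} (λ n → ℚₚ.*-identityˡ (seq x n)))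
                     , (λ x → ≡⇒≈ {x * 1ℝ} {x} (λ n → ℚₚ.*-identityʳ (seq x n)))
        ; distrib = (λ x y z → ≡⇒≈ {x * (y + z)} {x * y + x * z}
                      (λ n → ℚₚ.*-distribˡ-+ (seq x n) (seq y n) (seq z n)))
                  , (λ x y z → ≡⇒≈ {(y + z) * x} {y * x + z * x}
                      (λ n → ℚₚ.*-distribʳ-+ (seq x n) (seq y n) (seq z n)))
        }
      ; *-comm = λ x y → ≡⇒≈ {x * y} {y * x} (λ n → ℚₚ.*-comm (seq x n) (seq y n))
      }
    }

  private

    #-irrefl : ∀ {x y} → x ≈ y → ¬ (x # y)
    #-irrefl x≈y (ε , 0<ε , M , away) with x≈y ε 0<ε
    ... | N , near = ℚₚ.<-asym (near (M ℕ.⊔ N) (ℕₚ.m≤n⊔m M N))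
                               (away (M ℕ.⊔ N) (ℕₚ.m≤m⊔n M N))

    #-sym : ∀ {x y} → x # y → y # x
    #-sym {x} {y} (ε , 0<ε , away) = ε , 0<ε ,
      map-eventually (λ n → subst (ε ℚ.<_) (∣p-q∣≡∣q-p∣ (seq x n) (seq y n))) away

    away-from-term : ∀ {s} η → 0ℚ ℚ.< η → ∀ {N} →
      (∀ m n → N ℕ.≤ m → N ℕ.≤ n → ∣ s m ℚ.- s n ∣ ℚ.< η) →
      ∀ M → N ℕ.≤ M → η ℚ.+ η ℚ.< ∣ s M ∣ → AwayFrom0 s
    away-from-term {s} η 0<η {N} close M N≤M big = η , 0<η , N , λ n N≤n →
      stays-away (s M) (s n) big (close M n N≤M N≤n)

    #-cotrans : ∀ {x y} → x # y → ∀ z → (x # z) ⊎ (z # y)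
    #-cotrans {x} {y} (ε , 0<ε , K , away) z
      with cauchy (x - z) (ε ℚ.* ½ ℚ.* ½) (pos-* (pos-* 0<ε 0<½) 0<½)
         | cauchy (z - y) (ε ℚ.* ½ ℚ.* ½) (pos-* (pos-* 0<ε 0<½) 0<½)
    ... | M , xz | N , zy = decide
      where
      η = ε ℚ.* ½ ℚ.* ½
      0<η = pos-* (pos-* 0<ε 0<½) 0<½
      L = K ℕ.⊔ (M ℕ.⊔ N)
      K≤L : K ℕ.≤ L
      K≤L = ℕₚ.m≤m⊔n K (M ℕ.⊔ N)
      M≤L : M ℕ.≤ L
      M≤L = ℕₚ.≤-trans (ℕₚ.m≤m⊔n M N) (ℕₚ.m≤n⊔m K (M ℕ.⊔ N))
      N≤L : N ℕ.≤ L
      N≤L = ℕₚ.≤-trans (ℕₚ.m≤n⊔m M N) (ℕₚ.m≤n⊔m K (M ℕ.⊔ N))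
      a = seq x L ; b = seq z L ; c = seq y L
      4η : (η ℚ.+ η) ℚ.+ (η ℚ.+ η) ≡ ε
      4η = solve 1 (λ e → let h = e :* con ½ :* con ½ in (h :+ h) :+ (h :+ h) := e) refl ε
      decide : (x # z) ⊎ (z # y)
      decide with (η ℚ.+ η) ℚₚ.<? ∣ a ℚ.- b ∣ | (η ℚ.+ η) ℚₚ.<? ∣ b ℚ.- c ∣
      ... | yes big | _       = inj₁ (away-from-term η 0<η xz L M≤L big)
      ... | no _    | yes big = inj₂ (away-from-term η 0<η zy L N≤L big)
      ... | no ≮₁   | no ≮₂   = contradiction (away L K≤L) (≤⇒≯ (begin
        ∣ a ℚ.- c ∣                      ≡⟨ cong ∣_∣ (solve 3 (λ a b c → a :- c := (a :- b) :+ (b :- c)) refl a b c) ⟩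
        ∣ (a ℚ.- b) ℚ.+ (b ℚ.- c) ∣      ≤⟨ ℚₚ.∣p+q∣≤∣p∣+∣q∣ (a ℚ.- b) (b ℚ.- c) ⟩
        ∣ a ℚ.- b ∣ ℚ.+ ∣ b ℚ.- c ∣      ≤⟨ ℚₚ.+-mono-≤ (ℚₚ.≮⇒≥ ≮₁) (ℚₚ.≮⇒≥ ≮₂) ⟩
        (η ℚ.+ η) ℚ.+ (η ℚ.+ η)          ≡⟨ 4η ⟩
        ε                                ∎))

  ¬#⇒≈ : ∀ x y → ¬ (x # y) → x ≈ y
  ¬#⇒≈ x y ¬x#y ε 0<ε with cauchy (x - y) (ε ℚ.* ½ ℚ.* ½) (pos-* (pos-* 0<ε 0<½) 0<½)
  ... | N , close = N , near
    where
    η = ε ℚ.* ½ ℚ.* ½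
    0<η = pos-* (pos-* 0<ε 0<½) 0<½
    d = seq (x - y)
    dN≤2η : ∣ d N ∣ ℚ.≤ η ℚ.+ η
    dN≤2η = ℚₚ.≮⇒≥ (λ big → ¬x#y (away-from-term η 0<η close N ℕₚ.≤-refl big))
    near : ∀ n → N ℕ.≤ n → ∣ d n ∣ ℚ.< ε
    near n N≤n = begin-strict
      ∣ d n ∣                       ≤⟨ ∣p∣≤∣p-q∣+∣q∣ (d n) (d N) ⟩
      ∣ d n ℚ.- d N ∣ ℚ.+ ∣ d N ∣   <⟨ ℚₚ.+-mono-<-≤ (close n N N≤n ℕₚ.≤-refl) dN≤2η ⟩
      η ℚ.+ (η ℚ.+ η)               ≡⟨ ℚₚ.+-identityˡ (η ℚ.+ (η ℚ.+ η)) ⟨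
      0ℚ ℚ.+ (η ℚ.+ (η ℚ.+ η))      <⟨ ℚₚ.+-monoˡ-< (η ℚ.+ (η ℚ.+ η)) 0<η ⟩
      η ℚ.+ (η ℚ.+ (η ℚ.+ η))       ≡⟨ solve 1 (λ e → let h = e :* con ½ :* con ½ in h :+ (h :+ (h :+ h)) := e) refl ε ⟩
      ε                             ∎

  -- Inverses are taken termwise; finitely many terms may be 0, and the
  -- value there is irrelevant.

  private

    inv : ℚ → ℚ
    inv p with p ℚₚ.≟ 0ℚ
    ... | yes _   = 0ℚ
    ... | no  p≢0 = (ℚ.1/ p) {{ℚ.≢-nonZero p≢0}}

  private

    inv-inverse : ∀ p → p ≢ 0ℚ → p ℚ.* inv p ≡ 1ℚ
    inv-inverse p p≢0 with p ℚₚ.≟ 0ℚ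
    ... | yes p≡0 = contradiction p≡0 p≢0
    ... | no  p≢0 = ℚₚ.*-inverseʳ p {{ℚ.≢-nonZero p≢0}}

    away⇒≢0 : ∀ {ε p} → 0ℚ ℚ.< ε → ε ℚ.< ∣ p ∣ → p ≢ 0ℚ
    away⇒≢0 0<ε ε<∣p∣ refl = ℚₚ.<-asym 0<ε ε<∣p∣

    inv-bound : ∀ {ε δ p} → 0ℚ ℚ.< ε → 0ℚ ℚ.< δ → ε ℚ.* δ ≡ 1ℚ →
                ε ℚ.< ∣ p ∣ → ∣ inv p ∣ ℚ.≤ δ
    inv-bound {ε} {δ} {p} 0<ε 0<δ εδ≡1 ε<∣p∣ =
      ℚₚ.*-cancelˡ-≤-pos ε {{ℚ.positive 0<ε}} (begin
        ε ℚ.* ∣ inv p ∣      ≤⟨ ℚₚ.*-monoʳ-≤-nonNeg ∣ inv p ∣ {{ℚₚ.∣-∣-nonNeg (inv p)}} (ℚₚ.<⇒≤ ε<∣p∣) ⟩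
        ∣ p ∣ ℚ.* ∣ inv p ∣  ≡⟨ ℚₚ.∣p*q∣≡∣p∣*∣q∣ p (inv p) ⟨
        ∣ p ℚ.* inv p ∣      ≡⟨ cong ∣_∣ (inv-inverse p (away⇒≢0 0<ε ε<∣p∣)) ⟩
        1ℚ                   ≡⟨ εδ≡1 ⟨
        ε ℚ.* δ              ∎)

    inv-difference : ∀ p q → p ≢ 0ℚ → q ≢ 0ℚ →
      inv p ℚ.- inv q ≡ (ℚ.- (inv p ℚ.* inv q)) ℚ.* (p ℚ.- q) ℚ.+ 0ℚ ℚ.* (p ℚ.- q)
    inv-difference p q p≢0 q≢0 = begin-equality
      inv p ℚ.- inv q
        ≡⟨ cong₂ ℚ._-_ (ℚₚ.*-identityʳ (inv p)) (ℚₚ.*-identityʳ (inv q)) ⟨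
      inv p ℚ.* 1ℚ ℚ.- inv q ℚ.* 1ℚ
        ≡⟨ cong₂ (λ u v → inv p ℚ.* u ℚ.- inv q ℚ.* v)
                 (inv-inverse q q≢0) (inv-inverse p p≢0) ⟨
      inv p ℚ.* (q ℚ.* inv q) ℚ.- inv q ℚ.* (p ℚ.* inv p)
        ≡⟨ solve 4 (λ p q u v →
             u :* (q :* v) :- v :* (p :* u) :=
             (:- (u :* v)) :* (p :- q) :+ con 0ℚ :* (p :- q)) refl p q (inv p) (inv q) ⟩
      (ℚ.- (inv p ℚ.* inv q)) ℚ.* (p ℚ.- q) ℚ.+ 0ℚ ℚ.* (p ℚ.- q)
        ∎

    cauchy-inv : ∀ {s} → IsCauchy s → AwayFrom0 s → IsCauchy (λ n → inv (s n))
    cauchy-inv {s} cs (ε , 0<ε , N , away) with recip⁺ ε 0<ε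
    ... | δ , 0<δ , εδ≡1 = cauchy-increments {s} {s} {λ n → inv (s n)} cs cs
      ( δ ℚ.* δ , pos-* 0<δ 0<δ , N , λ m n m≥ n≥ →
        ℚ.- (inv (s m) ℚ.* inv (s n)) , 0ℚ ,
        bound m n m≥ n≥ , ℚₚ.<⇒≤ (pos-* 0<δ 0<δ) ,
        inv-difference (s m) (s n) (away⇒≢0 0<ε (away m m≥)) (away⇒≢0 0<ε (away n n≥)))
      where
      inv≤δ : ∀ n → N ℕ.≤ n → ∣ inv (s n) ∣ ℚ.≤ δ
      inv≤δ n n≥ = inv-bound {ε} {δ} {s n} 0<ε 0<δ εδ≡1 (away n n≥)
      bound : ∀ m n → N ℕ.≤ m → N ℕ.≤ n → ∣ ℚ.- (inv (s m) ℚ.* inv (s n)) ∣ ℚ.≤ δ ℚ.* δ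
      bound m n m≥ n≥ = begin
        ∣ ℚ.- (inv (s m) ℚ.* inv (s n)) ∣  ≡⟨ ℚₚ.∣-p∣≡∣p∣ (inv (s m) ℚ.* inv (s n)) ⟩
        ∣ inv (s m) ℚ.* inv (s n) ∣        ≡⟨ ℚₚ.∣p*q∣≡∣p∣*∣q∣ (inv (s m)) (inv (s n)) ⟩
        ∣ inv (s m) ∣ ℚ.* ∣ inv (s n) ∣    ≤⟨ ℚₚ.*-monoʳ-≤-nonNeg ∣ inv (s n) ∣ {{ℚₚ.∣-∣-nonNeg (inv (s n))}} (inv≤δ m m≥) ⟩
        δ ℚ.* ∣ inv (s n) ∣                ≤⟨ ℚₚ.*-monoˡ-≤-nonNeg δ {{ℚ.nonNegative (ℚₚ.<⇒≤ 0<δ)}} (inv≤δ n n≥) ⟩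
        δ ℚ.* δ                            ∎

  reciprocal : ∀ x → AwayFrom0 (seq x) → ℝ
  reciprocal x away = mkℝ (λ n → inv (seq x n)) (cauchy-inv {seq x} (cauchy x) away)

  private

    reciprocal-inverse : ∀ x away → x * reciprocal x away ≈ 1ℝ
    reciprocal-inverse x (ε , 0<ε , N , away) β 0<β = N , λ n N≤n →
      subst (λ p → ∣ p ∣ ℚ.< β)
        (sym (trans (cong (ℚ._- 1ℚ) (inv-inverse (seq x n) (away⇒≢0 0<ε (away n N≤n))))
                    (ℚₚ.+-inverseʳ 1ℚ)))
        0<β

    unit⇒away : ∀ x w → x * w ≈ 1ℝ → AwayFrom0 (seq x)
    unit⇒away x w xw≈1 with cauchy⇒bounded {seq w} (cauchy w)
    ... | B , 0<B , w≤B with recip⁺ B 0<B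
    ... | δ , 0<δ , Bδ≡1 = ½ ℚ.* δ , pos-* 0<½ 0<δ ,
      zip-eventually step w≤B (xw≈1 (½ ℚ.* ½) (pos-* 0<½ 0<½))
      where
      step : ∀ n → ∣ seq w n ∣ ℚ.≤ B →
             ∣ seq x n ℚ.* seq w n ℚ.- 1ℚ ∣ ℚ.< ½ ℚ.* ½ → ½ ℚ.* δ ℚ.< ∣ seq x n ∣
      step n wn≤B near = ℚₚ.*-cancelʳ-<-nonNeg B {{ℚ.nonNegative (ℚₚ.<⇒≤ 0<B)}} (begin-strict
        ½ ℚ.* δ ℚ.* B              ≡⟨ solve 2 (λ d b → con ½ :* d :* b := con ½ :* (b :* d)) refl δ B ⟩
        ½ ℚ.* (B ℚ.* δ)            ≡⟨ cong (½ ℚ.*_) Bδ≡1 ⟩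
        ½                          <⟨ stays-away 1ℚ (seq x n ℚ.* seq w n) ½+¼<1
                                        (subst (ℚ._< ½ ℚ.* ½) (∣p-q∣≡∣q-p∣ (seq x n ℚ.* seq w n) 1ℚ) near) ⟩
        ∣ seq x n ℚ.* seq w n ∣    ≡⟨ ℚₚ.∣p*q∣≡∣p∣*∣q∣ (seq x n) (seq w n) ⟩
        ∣ seq x n ∣ ℚ.* ∣ seq w n ∣ ≤⟨ ℚₚ.*-monoˡ-≤-nonNeg ∣ seq x n ∣ {{ℚₚ.∣-∣-nonNeg (seq x n)}} wn≤B ⟩
        ∣ seq x n ∣ ℚ.* B          ∎)
        where
        ½+¼<1 : ½ ℚ.+ ½ ℚ.* ½ ℚ.< ∣ 1ℚ ∣
        ½+¼<1 = ℚ.*<* (ℤ.+<+ (ℕₚ.m≤m+n 4 0))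

  heytingField : HeytingField 0ℓ 0ℓ 0ℓ
  heytingField = record
    { Carrier = ℝ ; _≈_ = _≈_ ; _#_ = _#_
    ; _+_ = _+_ ; _*_ = _*_ ; -_ = -_ ; 0# = 0ℝ ; 1# = 1ℝ
    ; isHeytingField = record
      { isHeytingCommutativeRing = record
        { isCommutativeRing = CommutativeRing.isCommutativeRing commutativeRing
        ; isApartnessRelation = record
          { irrefl  = λ {x} {y} → #-irrefl {x} {y}
          ; sym     = λ {x} {y} → #-sym {x} {y}
          ; cotrans = λ {x} {y} → #-cotrans {x} {y}
          }
        ; #⇒invertible = λ {x} {y} x#y →
            let z = x - y
                w = reciprocal z x#y
                zw≈1 = reciprocal-inverse z x#y
            in w , ≈-trans {w * z} {z * w} {1ℝ}
                     (≡⇒≈ {w * z} {z * w} (λ n → ℚₚ.*-comm (seq w n) (seq z n))) zw≈1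
                 , zw≈1
        ; invertible⇒# = λ {x} {y} (w , _ , zw≈1) → unit⇒away (x - y) w zw≈1
        }
      ; tight = λ x y → ¬#⇒≈ x y , #-irrefl {x} {y}
      }
    }

module BiPeriodicJacobsthal {c ℓ₁ ℓ₂ : Level} (F : HeytingField c ℓ₁ ℓ₂) where

  open HeytingField F
  open CommutativeRing (HeytingCommutativeRing.commutativeRing heytingCommutativeRing)
    using (semiring)
  open import Algebra.Properties.Semiring.Exp semiring using (_^_) public

  2# : Carrier
  2# = 1# + 1#

  infixl 7 _/_[_] _÷_[_]
  infixr 7 _·_
  infixl 6 _⊕_
  infix  4 _≋_

  -- `#⇒invertible` inverts a difference, here y - 0#.
  _/_[_] : Carrier → (y : Carrier) → y # 0# → Carrier
  x / y [ y#0 ] = x * proj₁ (#⇒invertible y#0)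

  Matrix : Set c
  Matrix = Vector (Vector Carrier 2) 2

  _≋_ : Matrix → Matrix → Set ℓ₁
  M ≋ N = ∀ i j → M i j ≈ N i j

  _⊕_ : Matrix → Matrix → Matrix
  (M ⊕ N) i j = M i j + N i j

  _·_ : Carrier → Matrix → Matrix
  (x · M) i j = x * M i j

  _÷_[_] : Matrix → (y : Carrier) → y # 0# → Matrix
  (M ÷ y [ y#0 ]) i j = M i j / y [ y#0 ]

  ⊕-rawMonoid : RawMonoid c ℓ₁
  ⊕-rawMonoid = record
    { Carrier = Matrix ; _≈_ = _≋_ ; _∙_ = _⊕_ ; ε = λ _ _ → 0# }

  open import Algebra.Definitions.RawMonoid ⊕-rawMonoid using (sum) public

  -- The upper bound n is excluded.
  ∑< : ℕ → (ℕ → Matrix) → Matrix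
  ∑< n M = sum {n} (λ k → M (toℕ k))

  ε : ℕ → ℕ
  ε n with ℕ.parity n
  ... | 0ℙ = 0
  ... | 1ℙ = 1

  module _ (a b : Carrier) (a#0 : a # 0#) where

    coefficient : ℕ → Carrier
    coefficient n with ℕ.parity n
    ... | 0ℙ = a
    ... | 1ℙ = b

    J : ℕ → Matrix
    J 0             = (1# ∷ 0# ∷ [])
                    ∷ (0# ∷ 1# ∷ [])
                    ∷ []
    J 1             = (b  ∷ 2# * (b / a [ a#0 ]) ∷ [])
                    ∷ (1# ∷ 0#                   ∷ [])
                    ∷ []
    J (suc (suc n)) = coefficient (suc (suc n)) · J (suc n) ⊕ 2# · J n

open HeytingField RealField.heytingField public
  using (_≈_; _#_; _+_; _*_; -_; _-_; 0#; 1#)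
open BiPeriodicJacobsthal RealField.heytingField public
  using (2#; _^_; Matrix; _≋_; _⊕_; _·_; _÷_[_]; ∑<; ε; J)

-- Multiply the sum by 1 − ab.  Put w n = a^ε(n) b^(1−ε(n)) and
-- w′ n = a^(1−ε(n)) b^ε(n): passing from n to n + 1 exchanges w and w′, their
-- product is always ab, and the recurrence reads
-- J (n + 2) = w (n + 1) J (n + 1) + 2 J n.  So the parity never has to be split:
-- the numerator grows by ((1 − w′) w + (1 − w)) J n = (1 − ab) J n from n to
-- n + 1, and it is (1 − ab) J 0 at n = 1.

module Submission where

open import Algebra.Apartness.Bundles using (HeytingField; HeytingCommutativeRing)
open import Algebra.Bundles using (CommutativeRing)
import Algebra.Properties.AbelianGroup as AbelianGroupProperties
import Algebra.Properties.Ring as RingProperties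
import Algebra.Solver.Ring.NaturalCoefficients.Default as SemiringSolver
open import Data.Nat.Base as ℕ using (ℕ; suc; _<_; _∸_)
open import Data.Parity.Base using (0ℙ; 1ℙ)
open import Data.Parity.Properties using (suc-homo-⁻¹)
open import Data.Product.Base using (proj₁; proj₂)
open import Relation.Binary.PropositionalEquality as ≡ using (_≡_)
import Relation.Binary.Reasoning.Setoid as SetoidReasoning
import Defs

module RingIdentities {c ℓ} (R : CommutativeRing c ℓ) where

  open CommutativeRing R
  open RingProperties ring using (x[y-z]≈xy-xz; [y-z]x≈yx-zx)
  open AbelianGroupProperties +-abelianGroup using (⁻¹-∙-comm)
  open SemiringSolver commutativeSemiring using (solve; _:=_; _:+_; _:*_; con)
  open SetoidReasoning setoid

  2# : Carrier
  2# = 1# + 1#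

  x-y+y≈x : ∀ x y → (x - y) + y ≈ x
  x-y+y≈x x y = begin
    (x - y) + y    ≈⟨ +-assoc x (- y) y ⟩
    x + (- y + y)  ≈⟨ +-congˡ (-‿inverseˡ y) ⟩
    x + 0#         ≈⟨ +-identityʳ x ⟩
    x              ∎

  x-y+y-z≈x-z : ∀ x y z → (x - y) + (y - z) ≈ x - z
  x-y+y-z≈x-z x y z = begin
    (x - y) + (y - z)    ≈⟨ +-assoc (x - y) y (- z) ⟨
    ((x - y) + y) - z    ≈⟨ +-congʳ (x-y+y≈x x y) ⟩
    x - z                ∎

  -- Expansion makes the left side telescope. With `x = w m` and `y = w′ m` it is the weight that
  -- `J m` gains between consecutive numerators.
  complements : ∀ x y → (1# - y) * x + (1# - x) ≈ 1# - x * y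
  complements x y = begin
    (1# - y) * x + (1# - x)       ≈⟨ +-congʳ ([y-z]x≈yx-zx x 1# y) ⟩
    (1# * x - y * x) + (1# - x)
      ≈⟨ +-congʳ (+-cong (*-identityˡ x) (-‿cong (*-comm y x))) ⟩
    (x - x * y) + (1# - x)        ≈⟨ +-comm _ _ ⟩
    (1# - x) + (x - x * y)        ≈⟨ x-y+y-z≈x-z 1# x (x * y) ⟩
    1# - x * y                    ∎

  -- For `x = b` and `y = a * b` this collects the two weights on `J 0` in the numerator at index 1:
  -- the multiples of `b` cancel, and 2 - 1 leaves 1.
  double-complement : ∀ x y →
    2# * (1# - x) + (2# * x - y - 1#) ≈ 1# - y
  double-complement x y = begin
    2# * (1# - x) + (2# * x - y - 1#)
      ≈⟨ +-congʳ (trans (x[y-z]≈xy-xz 2# 1# x) (+-congʳ (*-identityʳ 2#))) ⟩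
    (2# - 2# * x) + (2# * x - y - 1#)
      ≈⟨ +-congˡ (trans (+-assoc _ _ _) (+-congˡ (⁻¹-∙-comm y 1#))) ⟩
    (2# - 2# * x) + (2# * x - (y + 1#))
      ≈⟨ x-y+y-z≈x-z 2# (2# * x) (y + 1#) ⟩
    2# - (y + 1#)
      ≈⟨ +-congˡ (trans (-‿cong (+-comm y 1#)) (sym (⁻¹-∙-comm 1# y))) ⟩
    2# + (- 1# - y)
      ≈⟨ +-assoc 2# (- 1#) (- y) ⟨
    (1# + 1# - 1#) - y
      ≈⟨ +-congʳ (trans (+-assoc 1# 1# (- 1#)) (trans (+-congˡ (-‿inverseʳ 1#)) (+-identityʳ 1#))) ⟩
    1# - y ∎

  -- The differences `1 - w′`, `1 - w` and `1 - ab` enter as atoms `p`, `q`, `r`, so that the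
  -- semiring solver applies; the hypothesis is the only relation among them that the induction step
  -- uses. Here `y`, `z` stand for consecutive terms of `J`, and `k`, `l` for the two fixed terms.
  numerator-step : ∀ {p q r w} y z k l → p * w + q ≈ r →
    p * (w * y + 2# * z) + (2# * q) * y + k + l ≈
    (q * y + (2# * p) * z + k + l) + r * y
  numerator-step {p} {q} {r} {w} y z k l pw+q≈r = begin
    p * (w * y + 2# * z) + (2# * q) * y + k + l
      ≈⟨ solve 7 (λ p q w y z k l →
           p :* (w :* y :+ two :* z) :+ (two :* q) :* y :+ k :+ l :=
           (q :* y :+ (two :* p) :* z :+ k :+ l) :+ (p :* w :+ q) :* y)
           refl p q w y z k l ⟩
    (q * y + (2# * p) * z + k + l) + (p * w + q) * y
      ≈⟨ +-congˡ (*-congʳ pw+q≈r) ⟩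
    (q * y + (2# * p) * z + k + l) + r * y ∎
    where two = con 1 :+ con 1

  -- At index 1 the moving terms coincide with the fixed ones, so like terms merge: the weights on
  -- `y` cancel and those on `z` add up to `r`.
  numerator-base : ∀ {p q k r s} y z → p + k ≈ 0# → 2# * q + s ≈ r →
    p * y + (2# * q) * z + k * y + s * z ≈ r * z
  numerator-base {p} {q} {k} {r} {s} y z p+k≈0 2q+s≈r = begin
    p * y + (2# * q) * z + k * y + s * z
      ≈⟨ solve 6 (λ p q k s y z →
           p :* y :+ q :* z :+ k :* y :+ s :* z :=
           (p :+ k) :* y :+ (q :+ s) :* z) refl p (2# * q) k s y z ⟩
    (p + k) * y + (2# * q + s) * z
      ≈⟨ +-cong (trans (*-congʳ p+k≈0) (zeroˡ y)) (*-congʳ 2q+s≈r) ⟩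
    0# + r * z
      ≈⟨ +-identityˡ (r * z) ⟩
    r * z ∎

  x*y≈z⇒y≈z*x⁻¹ : ∀ {x x⁻¹ y z} → x * x⁻¹ ≈ 1# → x * y ≈ z → y ≈ z * x⁻¹
  x*y≈z⇒y≈z*x⁻¹ {x} {x⁻¹} {y} {z} xx⁻¹≈1 xy≈z = begin
    y              ≈⟨ *-identityˡ y ⟨
    1# * y         ≈⟨ *-congʳ xx⁻¹≈1 ⟨
    x * x⁻¹ * y    ≈⟨ solve 3 (λ x v y → x :* v :* y := x :* y :* v) refl x x⁻¹ y ⟩
    x * y * x⁻¹    ≈⟨ *-congʳ xy≈z ⟩
    z * x⁻¹        ∎

module PartialSums {c ℓ₁ ℓ₂} (F : HeytingField c ℓ₁ ℓ₂) where

  open HeytingField F using (heytingCommutativeRing; _#_; #⇒invertible)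
  R : CommutativeRing c ℓ₁
  R = HeytingCommutativeRing.commutativeRing heytingCommutativeRing
  open CommutativeRing R
  open Defs.BiPeriodicJacobsthal F
  open RingIdentities R hiding (2#)
  open RingProperties ring using (-0#≈0#)
  open SetoidReasoning setoid

  -- `sum` peels off the first term, whereas the induction adds the last one; shifting `M`
  -- reconciles the two.
  ∑<-suc : ∀ n M → ∑< (suc n) M ≋ ∑< n M ⊕ M n
  ∑<-suc ℕ.zero  M i j = +-comm (M 0 i j) 0#
  ∑<-suc (suc n) M i j = begin
    M 0 i j + ∑< (suc n) (λ k → M (suc k)) i j
      ≈⟨ +-congˡ (∑<-suc n (λ k → M (suc k)) i j) ⟩
    M 0 i j + (∑< n (λ k → M (suc k)) i j + M (suc n) i j)
      ≈⟨ +-assoc _ _ _ ⟨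
    M 0 i j + ∑< n (λ k → M (suc k)) i j + M (suc n) i j
      ∎

  x*y≈z⇒y≈z/x : ∀ {x y z} (x#0 : x # 0#) → x * y ≈ z → y ≈ z / x [ x#0 ]
  x*y≈z⇒y≈z/x {x} x#0 = x*y≈z⇒y≈z*x⁻¹ (begin
    -- The inverse supplied by the field is that of `x - 0#`, which is first identified with `x`.
    x * x⁻¹          ≈⟨ *-congʳ (trans (+-congˡ -0#≈0#) (+-identityʳ x)) ⟨
    (x - 0#) * x⁻¹   ≈⟨ proj₂ (proj₂ (#⇒invertible x#0)) ⟩
    1#               ∎)
    where x⁻¹ = proj₁ (#⇒invertible x#0)

  module _ (a b : Carrier) where

    w w′ : ℕ → Carrier
    w  n = a ^ ε n * b ^ (1 ∸ ε n)
    w′ n = a ^ (1 ∸ ε n) * b ^ ε n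

    private
      a¹b⁰≈a : a ^ 1 * b ^ 0 ≈ a
      a¹b⁰≈a = trans (*-identityʳ _) (*-identityʳ a)

      a⁰b¹≈b : a ^ 0 * b ^ 1 ≈ b
      a⁰b¹≈b = trans (*-identityˡ _) (*-identityʳ b)

    ε-suc : ∀ n → ε (suc n) ≡ 1 ∸ ε n
    -- The third scrutinee says that the two parities are opposite, which excludes the cases where
    -- they agree.
    ε-suc n with ℕ.parity (suc n) | ℕ.parity n | suc-homo-⁻¹ n
    ... | 0ℙ | 1ℙ | _ = ≡.refl
    ... | 1ℙ | 0ℙ | _ = ≡.refl

    -- Truncated subtraction undoes itself here because `ε n` is at most 1; hence `suc` merely swaps
    -- the exponents of `a` and `b`.
    1∸[1∸ε] : ∀ n → 1 ∸ (1 ∸ ε n) ≡ ε n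
    1∸[1∸ε] n with ℕ.parity n
    ... | 0ℙ = ≡.refl
    ... | 1ℙ = ≡.refl

    w-suc : ∀ n → w (suc n) ≡ w′ n
    w-suc n rewrite ε-suc n | 1∸[1∸ε] n = ≡.refl

    w′-suc : ∀ n → w′ (suc n) ≡ w n
    w′-suc n rewrite ε-suc n | 1∸[1∸ε] n = ≡.refl

    w*w′≈a*b : ∀ n → w n * w′ n ≈ a * b
    w*w′≈a*b n with ℕ.parity n
    ... | 0ℙ = trans (*-cong a⁰b¹≈b a¹b⁰≈a) (*-comm b a)
    ... | 1ℙ = *-cong a¹b⁰≈a a⁰b¹≈b

    module _ (a#0 : a # 0#) where

      coefficient≈w′ : ∀ n → coefficient a b a#0 n ≈ w′ n
      coefficient≈w′ n with ℕ.parity n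
      ... | 0ℙ = sym a¹b⁰≈a
      ... | 1ℙ = sym a⁰b¹≈b

      -- `coefficient` is indexed by the term being produced, `w` by the term being multiplied; the
      -- shift turns `w′` into `w`.
      coefficient-suc≈w : ∀ n → coefficient a b a#0 (suc n) ≈ w n
      coefficient-suc≈w n = trans (coefficient≈w′ (suc n)) (reflexive (w′-suc n))

      private
        Jₙ : ℕ → Matrix
        Jₙ = J a b a#0

      numerator : ℕ → Matrix
      numerator n =
        (1# - w n) · Jₙ n
          ⊕ (2# * (1# - w′ n)) · Jₙ (n ∸ 1)
          ⊕ (a - 1#) · Jₙ 1
          ⊕ (2# * b - a * b - 1#) · Jₙ 0

      [1-ab]·∑<≋numerator : ∀ n → (1# - a * b) · ∑< (suc n) Jₙ ≋ numerator (suc n)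
      [1-ab]·∑<≋numerator ℕ.zero i j = begin
        (1# - a * b) * (Jₙ 0 i j + 0#)
          ≈⟨ *-congˡ (+-identityʳ (Jₙ 0 i j)) ⟩
        (1# - a * b) * Jₙ 0 i j
          ≈⟨ numerator-base (Jₙ 1 i j) (Jₙ 0 i j)
               (begin
                 (1# - w 1) + (a - 1#)  ≈⟨ +-congʳ (+-congˡ (-‿cong a¹b⁰≈a)) ⟩
                 (1# - a) + (a - 1#)    ≈⟨ x-y+y-z≈x-z 1# a 1# ⟩
                 1# - 1#                ≈⟨ -‿inverseʳ 1# ⟩
                 0#                     ∎)
               (trans (+-congʳ (*-congˡ (+-congˡ (-‿cong a⁰b¹≈b))))
                      (double-complement b (a * b))) ⟨
        numerator 1 i j ∎
      [1-ab]·∑<≋numerator (suc n) i j = begin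
        (1# - a * b) * ∑< (suc m) Jₙ i j
          ≈⟨ *-congˡ (∑<-suc m Jₙ i j) ⟩
        (1# - a * b) * (∑< m Jₙ i j + Jₙ m i j)
          ≈⟨ distribˡ _ _ _ ⟩
        (1# - a * b) * ∑< m Jₙ i j + (1# - a * b) * Jₙ m i j
          ≈⟨ +-congʳ ([1-ab]·∑<≋numerator n i j) ⟩
        numerator m i j + (1# - a * b) * Jₙ m i j
          -- Read from right to left, with `p = 1 - w′ m`, `q = 1 - w m` and `r = 1 - ab`.
          ≈⟨ numerator-step (Jₙ m i j) (Jₙ n i j) _ _
               (trans (complements (w m) (w′ m)) (+-congˡ (-‿cong (w*w′≈a*b m)))) ⟨
        (1# - w′ m) * (w m * Jₙ m i j + 2# * Jₙ n i j) + (2# * (1# - w m)) * Jₙ m i j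
          + ((a - 1#) · Jₙ 1) i j + ((2# * b - a * b - 1#) · Jₙ 0) i j
          -- Passing to index `suc m` exchanges `w` and `w′`, and the bracket becomes the recurrence
          -- for `J (suc m)`.
          ≈⟨ +-congʳ (+-congʳ (+-cong
               (*-cong (+-congˡ (-‿cong (reflexive (≡.sym (w-suc m)))))
                       (+-congʳ (*-congʳ (sym (coefficient-suc≈w m)))))
               (*-congʳ (*-congˡ (+-congˡ (-‿cong (reflexive (≡.sym (w′-suc m))))))))) ⟩
        numerator (suc m) i j ∎
        where m = suc n

      ∑<≋numerator÷[1-ab] : (1-ab#0 : 1# - a * b # 0#) → ∀ n →
        ∑< (suc n) Jₙ ≋ numerator (suc n) ÷ (1# - a * b) [ 1-ab#0 ]
      ∑<≋numerator÷[1-ab] 1-ab#0 n i j =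
        x*y≈z⇒y≈z/x 1-ab#0 ([1-ab]·∑<≋numerator n i j)

open import Defs

theorem9 : (a b : ℝ) (a#0 : a # 0#) (b#0 : b # 0#) (1-ab#0 : 1# - a * b # 0#) →
    let Jₙ = J a b a#0 in
    (n : ℕ) → 0 < n →
    ∑< n Jₙ ≋
    ((1# - a ^ ε n * b ^ (1 ∸ ε n)) · Jₙ n
    ⊕ (2# * (1# - a ^ (1 ∸ ε n) * b ^ ε n)) · Jₙ (n ∸ 1)
    ⊕ (a - 1#) · Jₙ 1
    ⊕ (2# * b - a * b - 1#) · Jₙ 0)
    ÷ (1# - a * b) [ 1-ab#0 ]
theorem9 a b a#0 b#0 1-ab#0 (suc n) _ =
  PartialSums.∑<≋numerator÷[1-ab] RealField.heytingField a b a#0 1-ab#0 n
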